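{- Let $\theta>1$ be real with $\log\theta=p/q>1$ rational, where $p,q$ are positive integers. Then $\mathcal A_\theta\subseteq [1,\frac{p^2}{6q})$; in particular $\mathcal A_\theta$ is finite.
   Context: $\lfloor x\rfloor$ is the floor of $x$; $\log$ is the natural logarithm. For real $\theta>1$ and positive integer $n$, $M'_\theta(n)=\left\lfloor 1/(\theta^{1/n}-1)\right\rfloor$, and $\mathcal A_\theta=\{n\in\mathbb N: M'_\theta(n)\neq \lfloor n/\log\theta-1/2\rfloor\}$, where $\mathbb N$ is the set of positive integers. -}

module Defs where

open import Algebra.Bundles.Raw using (RawRing)
open import Data.Integer.Base as ℤ using (ℤ; +_)
open import Data.List.Base using (List)
open import Data.List.Membership.Propositional using (_∈_)
open import Data.Nat.Base as ℕ using (ℕ; zero; suc; _!)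
import Data.Nat.Properties as ℕ
open import Data.Product.Base using (∃; ∃₂; _×_; _,_)
open import Data.Rational.Base as ℚ using (ℚ; 0ℚ; 1ℚ; ½; ∣_∣; _/_; positive)
import Data.Rational.Properties as ℚ
import Data.Rational.Solver as ℚ
open import Level using (0ℓ)
open import Relation.Binary.Core using (Rel)
open import Relation.Binary.PropositionalEquality
open import Relation.Unary using (Pred; _⊆_)

Eventually : Pred ℕ 0ℓ → Set
Eventually P = ∃ λ N → ∀ n → N ℕ.≤ n → P n

IsCauchy : (ℕ → ℚ) → Set
IsCauchy x = ∀ ε → 0ℚ ℚ.< ε →
  ∃ λ N → ∀ m n → N ℕ.≤ m → N ℕ.≤ n → ∣ x m ℚ.- x n ∣ ℚ.< ε

-- The real numbers: Cauchy sequences of rationals, carrying a modulus of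
-- convergence, under the setoid equality _≃_.
record ℝ : Set where
  constructor mkℝ
  field
    seq    : ℕ → ℚ
    cauchy : IsCauchy seq

open ℝ public

infix 4 _≃_ _<_ _≤_

_≃_ : Rel ℝ 0ℓ
x ≃ y = ∀ ε → 0ℚ ℚ.< ε → Eventually λ n → ∣ seq x n ℚ.- seq y n ∣ ℚ.< ε

_<_ : Rel ℝ 0ℓ
x < y = ∃ λ ε → 0ℚ ℚ.< ε × Eventually λ n → seq x n ℚ.+ ε ℚ.< seq y n

_≤_ : Rel ℝ 0ℓ
x ≤ y = ∀ ε → 0ℚ ℚ.< ε → Eventually λ n → seq x n ℚ.< seq y n ℚ.+ ε

private
  open ℚ.+-*-Solver

  ⊔ˡ : ∀ {i j k} → i ℕ.⊔ j ℕ.≤ k → i ℕ.≤ k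
  ⊔ˡ = ℕ.≤-trans (ℕ.m≤m⊔n _ _)

  ⊔ʳ : ∀ {i j k} → i ℕ.⊔ j ℕ.≤ k → j ℕ.≤ k
  ⊔ʳ {i} = ℕ.≤-trans (ℕ.m≤n⊔m i _)

  half : ∀ ε → ½ ℚ.* ε ℚ.+ ½ ℚ.* ε ≡ ε
  half ε = trans (sym (ℚ.*-distribʳ-+ ε ½ ½)) (ℚ.*-identityˡ ε)

  half-pos : ∀ {ε} → 0ℚ ℚ.< ε → 0ℚ ℚ.< ½ ℚ.* ε
  half-pos {ε} 0<ε = ℚ.positive⁻¹ _ {{ℚ.pos*pos⇒pos ½ ε {{positive 0<ε}}}}

  -- A positive δ with b * δ = ε.
  quotient : ∀ {b ε} → 0ℚ ℚ.< b → 0ℚ ℚ.< ε → ∃ λ δ → 0ℚ ℚ.< δ × b ℚ.* δ ≡ ε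
  quotient {b} {ε} 0<b 0<ε = b⁻¹ ℚ.* ε , 0<δ , eq
    where
    instance
      b-pos = positive 0<b
      b-nz  = ℚ.pos⇒nonZero b
      ε-pos = positive 0<ε
    b⁻¹ = ℚ.1/ b
    0<δ = ℚ.positive⁻¹ _ {{ℚ.pos*pos⇒pos b⁻¹ {{ℚ.1/pos⇒pos b}} ε}}
    eq  = trans (sym (ℚ.*-assoc b b⁻¹ ε))
         (trans (cong (ℚ._* ε) (ℚ.*-inverseʳ b)) (ℚ.*-identityˡ ε))

  bounded : ∀ x → IsCauchy x →
            ∃ λ b → 0ℚ ℚ.< b × Eventually λ n → ∣ x n ∣ ℚ.≤ b
  bounded x cx with N , h ← cx 1ℚ (ℚ.positive⁻¹ 1ℚ) =
    b , 0<b , N , λ n N≤n → begin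
      ∣ x n ∣                      ≡⟨ cong ∣_∣ (split (x n) (x N)) ⟩
      ∣ (x n ℚ.- x N) ℚ.+ x N ∣     ≤⟨ ℚ.∣p+q∣≤∣p∣+∣q∣ (x n ℚ.- x N) (x N) ⟩
      ∣ x n ℚ.- x N ∣ ℚ.+ ∣ x N ∣    ≤⟨ ℚ.+-monoˡ-≤ ∣ x N ∣ (ℚ.<⇒≤ (h n N N≤n ℕ.≤-refl)) ⟩
      1ℚ ℚ.+ ∣ x N ∣               ∎
    where
    open ℚ.≤-Reasoning
    b = 1ℚ ℚ.+ ∣ x N ∣
    0<b : 0ℚ ℚ.< b
    0<b = ℚ.+-mono-<-≤ (ℚ.positive⁻¹ 1ℚ) (ℚ.0≤∣p∣ (x N))
    split : ∀ p q → p ≡ (p ℚ.- q) ℚ.+ q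
    split = solve 2 (λ p q → p := (p :- q) :+ q) refl

  const-cauchy : ∀ q → IsCauchy (λ _ → q)
  const-cauchy q ε 0<ε = 0 , λ _ _ _ _ →
    subst (λ r → ∣ r ∣ ℚ.< ε) (sym (ℚ.+-inverseʳ q)) 0<ε

  +-cauchy : ∀ x y → IsCauchy x → IsCauchy y → IsCauchy (λ n → x n ℚ.+ y n)
  +-cauchy x y cx cy ε 0<ε
    with M , f ← cx (½ ℚ.* ε) (half-pos 0<ε)
       | N , g ← cy (½ ℚ.* ε) (half-pos 0<ε) =
    M ℕ.⊔ N , λ m n m≥ n≥ → begin-strict
      ∣ (x m ℚ.+ y m) ℚ.- (x n ℚ.+ y n) ∣     ≡⟨ cong ∣_∣ (regroup (x m) (y m) (x n) (y n)) ⟩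
      ∣ (x m ℚ.- x n) ℚ.+ (y m ℚ.- y n) ∣     ≤⟨ ℚ.∣p+q∣≤∣p∣+∣q∣ (x m ℚ.- x n) (y m ℚ.- y n) ⟩
      ∣ x m ℚ.- x n ∣ ℚ.+ ∣ y m ℚ.- y n ∣     <⟨ ℚ.+-mono-<
        (f m n (⊔ˡ {M} m≥) (⊔ˡ {M} n≥))
        (g m n (⊔ʳ {M} m≥) (⊔ʳ {M} n≥)) ⟩
      ½ ℚ.* ε ℚ.+ ½ ℚ.* ε                    ≡⟨ half ε ⟩
      ε                                      ∎
    where
    open ℚ.≤-Reasoning
    regroup : ∀ a b c d → (a ℚ.+ b) ℚ.- (c ℚ.+ d) ≡ (a ℚ.- c) ℚ.+ (b ℚ.- d)
    regroup = solve 4 (λ a b c d →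
      (a :+ b) :- (c :+ d) := (a :- c) :+ (b :- d)) refl

  neg-cauchy : ∀ x → IsCauchy x → IsCauchy (λ n → ℚ.- x n)
  neg-cauchy x cx ε 0<ε with N , f ← cx ε 0<ε = N , λ m n m≥ n≥ →
    subst (ℚ._< ε) (sym (trans (cong ∣_∣ (regroup (x m) (x n))) (ℚ.∣-p∣≡∣p∣ _)))
      (f m n m≥ n≥)
    where
    regroup : ∀ a b → ℚ.- a ℚ.- (ℚ.- b) ≡ ℚ.- (a ℚ.- b)
    regroup = solve 2 (λ a b → (:- a) :- (:- b) := :- (a :- b)) refl

  regroup-* : ∀ a b c d →
    a ℚ.* b ℚ.- c ℚ.* d ≡ a ℚ.* (b ℚ.- d) ℚ.+ d ℚ.* (a ℚ.- c)
  regroup-* = solve 4 (λ a b c d →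
    a :* b :- c :* d := a :* (b :- d) :+ d :* (a :- c)) refl

  scale : ∀ u v {c d} → 0ℚ ℚ.< c → ∣ u ∣ ℚ.≤ c → ∣ v ∣ ℚ.< d →
          ∣ u ℚ.* v ∣ ℚ.< c ℚ.* d
  scale u v {c} {d} 0<c u≤c v<d = begin-strict
    ∣ u ℚ.* v ∣        ≡⟨ ℚ.∣p*q∣≡∣p∣*∣q∣ u v ⟩
    ∣ u ∣ ℚ.* ∣ v ∣    ≤⟨ ℚ.*-monoʳ-≤-nonNeg ∣ v ∣ {{ℚ.∣-∣-nonNeg v}} u≤c ⟩
    c ℚ.* ∣ v ∣        <⟨ ℚ.*-monoʳ-<-pos c {{positive 0<c}} v<d ⟩
    c ℚ.* d            ∎
    where open ℚ.≤-Reasoning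

  *-close : ∀ a b c d {A B δ η} → 0ℚ ℚ.< A → 0ℚ ℚ.< B →
            ∣ a ∣ ℚ.≤ A → ∣ d ∣ ℚ.≤ B → ∣ b ℚ.- d ∣ ℚ.< δ → ∣ a ℚ.- c ∣ ℚ.< η →
            ∣ a ℚ.* b ℚ.- c ℚ.* d ∣ ℚ.< A ℚ.* δ ℚ.+ B ℚ.* η
  *-close a b c d {A} {B} {δ} {η} 0<A 0<B a≤A d≤B b-d<δ a-c<η = begin-strict
    ∣ a ℚ.* b ℚ.- c ℚ.* d ∣                               ≡⟨ cong ∣_∣ (regroup-* a b c d) ⟩
    ∣ a ℚ.* (b ℚ.- d) ℚ.+ d ℚ.* (a ℚ.- c) ∣               ≤⟨ ℚ.∣p+q∣≤∣p∣+∣q∣ (a ℚ.* (b ℚ.- d)) (d ℚ.* (a ℚ.- c)) ⟩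
    ∣ a ℚ.* (b ℚ.- d) ∣ ℚ.+ ∣ d ℚ.* (a ℚ.- c) ∣           <⟨ ℚ.+-mono-<
      (scale a (b ℚ.- d) 0<A a≤A b-d<δ) (scale d (a ℚ.- c) 0<B d≤B a-c<η) ⟩
    A ℚ.* δ ℚ.+ B ℚ.* η                                   ∎
    where open ℚ.≤-Reasoning

  *-cauchy : ∀ x y → IsCauchy x → IsCauchy y → IsCauchy (λ n → x n ℚ.* y n)
  *-cauchy x y cx cy ε 0<ε =
    let a , 0<a , K , ∣x∣≤a = bounded x cx
        b , 0<b , L , ∣y∣≤b = bounded y cy
        δ , 0<δ , aδ≡ε/2 = quotient {a} 0<a (half-pos 0<ε)
        η , 0<η , bη≡ε/2 = quotient {b} 0<b (half-pos 0<ε)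
        M , f = cx η 0<η
        N , g = cy δ 0<δ
        aδ+bη≡ε = trans (cong₂ ℚ._+_ aδ≡ε/2 bη≡ε/2) (half ε)
    in (K ℕ.⊔ L) ℕ.⊔ (M ℕ.⊔ N) , λ m n m≥ n≥ →
      let m≥KL , m≥MN = ⊔ˡ {K ℕ.⊔ L} m≥ , ⊔ʳ {K ℕ.⊔ L} m≥
          n≥KL , n≥MN = ⊔ˡ {K ℕ.⊔ L} n≥ , ⊔ʳ {K ℕ.⊔ L} n≥
      in subst (∣ x m ℚ.* y m ℚ.- x n ℚ.* y n ∣ ℚ.<_) aδ+bη≡ε
           (*-close (x m) (y m) (x n) (y n) 0<a 0<b
             (∣x∣≤a m (⊔ˡ {K} m≥KL)) (∣y∣≤b n (⊔ʳ {K} n≥KL))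
             (g m n (⊔ʳ {M} m≥MN) (⊔ʳ {M} n≥MN))
             (f m n (⊔ˡ {M} m≥MN) (⊔ˡ {M} n≥MN)))

fromℚ : ℚ → ℝ
fromℚ q = mkℝ (λ _ → q) (const-cauchy q)

fromℤ : ℤ → ℝ
fromℤ i = fromℚ (i / 1)

fromℕ : ℕ → ℝ
fromℕ n = fromℤ (+ n)

0ℝ 1ℝ : ℝ
0ℝ = fromℚ 0ℚ
1ℝ = fromℚ 1ℚ

infix  8 -_
infixl 7 _*_
infixl 6 _+_ _-_

_+_ : ℝ → ℝ → ℝ
x + y = mkℝ (λ n → seq x n ℚ.+ seq y n) (+-cauchy (seq x) (seq y) (cauchy x) (cauchy y))

_*_ : ℝ → ℝ → ℝ
x * y = mkℝ (λ n → seq x n ℚ.* seq y n) (*-cauchy (seq x) (seq y) (cauchy x) (cauchy y))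

-_ : ℝ → ℝ
- x = mkℝ (λ n → ℚ.- seq x n) (neg-cauchy (seq x) (cauchy x))

_-_ : ℝ → ℝ → ℝ
x - y = x + (- y)

rawRing : RawRing 0ℓ 0ℓ
rawRing = record
  { Carrier = ℝ ; _≈_ = _≃_ ; _+_ = _+_ ; _*_ = _*_ ; -_ = -_
  ; 0# = 0ℝ ; 1# = 1ℝ }

open import Algebra.Definitions.RawSemiring (RawRing.rawSemiring rawRing)
  public using (_^_)

infix 4 _⟶_

_⟶_ : (ℕ → ℝ) → ℝ → Set
s ⟶ l = ∀ ε → 0ℚ ℚ.< ε →
  Eventually λ n → l - fromℚ ε < s n × s n < l + fromℚ ε

expSum : ℝ → ℕ → ℝ
expSum x zero    = 0ℝ
expSum x (suc n) = expSum x n + fromℚ ((+ 1 / (n !)) {{n ℕ.!≢0}}) * x ^ n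

-- Log, roots, reciprocals and floors are partial functions on ℝ, and the floor
-- is not computable; each is given by its graph.  The value, where there is
-- one, is unique up to _≃_ (up to _≡_ for floors).

IsExp : ℝ → ℝ → Set
IsExp x y = expSum x ⟶ y

IsLog : ℝ → ℝ → Set
IsLog x l = IsExp l x

IsRoot : ℕ → ℝ → ℝ → Set
IsRoot n x r = 0ℝ < r × r ^ n ≃ x

IsReciprocal : ℝ → ℝ → Set
IsReciprocal x y = x * y ≃ 1ℝ

IsFloor : ℝ → ℤ → Set
IsFloor x k = fromℤ k ≤ x × x < fromℤ (ℤ.suc k)

-- m = ⌊ 1 / (θ^(1/n) - 1) ⌋
IsM′ : ℝ → ℕ → ℤ → Set
IsM′ θ n m = ∃₂ λ r s → IsRoot n θ r × IsReciprocal (r - 1ℝ) s × IsFloor s m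

-- k = ⌊ n / log θ - 1/2 ⌋
IsLogFloor : ℝ → ℕ → ℤ → Set
IsLogFloor θ n k = ∃₂ λ l s →
  IsLog θ l × IsReciprocal l s × IsFloor (fromℕ n * s - fromℚ ½) k

-- Constructively, asking only that no integer be the value of both floors
-- makes this set at least as large as also asking that both floors exist.
𝒜 : ℝ → Pred ℕ 0ℓ
𝒜 θ n = ℕ.NonZero n × (∀ {m k} → IsM′ θ n m → IsLogFloor θ n k → m ≢ k)

[_,_⟩ : ℚ → ℚ → Pred ℕ 0ℓ
[ a , b ⟩ n = a ℚ.≤ + n / 1 × + n / 1 ℚ.< b

-- Classically equivalent to having an exact list of the elements, which for
-- an undecidable P cannot be extracted even from a bound.
Finite : Pred ℕ 0ℓ → Set
Finite P = ∃ λ (xs : List ℕ) → P ⊆ (_∈ xs)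

module Submission where

-- With x = log θ / n = p / qn, one has 1/x - 1/2 < 1/(eˣ - 1) < 1/x - 1/2 + x/12
-- for all x > 0.  Here 1/x - 1/2 = (2nq - p) / 2p has denominator 2p, so it lies at
-- least 1/2p below the next integer, and the two floors agree once x/12 ≤ 1/2p,
-- that is, once n ≥ p²/6q.  For such n the witnesses are θ^(1/n) = lim Eₙ(x), with
-- Eₙ the partial sums of the exponential series, and 1/(θ^(1/n) - 1) = lim 1/(Eₙ(x) - 1);
-- their rate of convergence is inherited from that of Eₙ(log θ) to θ.

open import Data.Integer.Base as ℤ using (ℤ; +_)
import Data.Integer.DivMod as ℤ
import Data.Integer.Properties as ℤ
open import Data.List.Base using (upTo)
open import Data.List.Membership.Propositional.Properties using (∈-upTo⁺)
open import Data.Nat.Base as ℕ using (ℕ; zero; suc; NonZero; _!)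
import Data.Nat.Properties as ℕ
open import Data.Nat.Properties using (m*n≢0)
open import Data.Product.Base using (∃; _×_; _,_; proj₂)
import Data.Rational.Base as ℚ
import Data.Rational.Properties as ℚ
open import Data.Rational.Solver using (module +-*-Solver)
import Data.Rational.Unnormalised.Base as ℚᵘ
import Data.Rational.Unnormalised.Properties as ℚᵘ
open import Data.Sum.Base using (inj₁; inj₂)
open import Function.Base using (_∘_)
open import Relation.Binary.PropositionalEquality
open import Relation.Nullary.Negation.Core using (¬_)
open import Relation.Unary using (_⊆_)
open +-*-Solver using (solve; _:+_; _:*_; _:-_; :-_; _:=_; con)

-- No exponential function on ℝ is constructed. All terms being nonnegative, the functional equation
-- becomes two inequalities between partial sums, Eₙ(kx) ≤ Eₙ(x)ᵏ ≤ Eₖₙ(kx); with kx = log θ both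
-- outer terms tend to θ. The analysis thus takes place in ℚ, and reals enter only at the end. The
-- bounds stop the Laurent expansion 1/x - 1/2 + x/12 - x³/720 + ... before and after the term x/12.
-- Since Eₙ(x) increases with n, the reciprocals 1/(Eₙ(x) - 1) decrease: the lower bound has to hold
-- at every truncation, while one good truncation settles the upper bound for all later ones and
-- supplies the fixed rational gap that `_<_` on ℝ demands. Refuting membership in `𝒜` takes actual
-- values of both floors, so one integer `k` is computed by integer division and shown to be both.

module _ where
  open import Algebra.Definitions.RawSemiring ℚ.+-*-rawSemiring using (_^_)
  open import Data.Rational.Base
    using (ℚ; 0ℚ; 1ℚ; ½; _+_; _*_; _-_; _≤_; _<_; _/_; ∣_∣; positive; nonNegative; 1/_)

  -- Integers, fractions and order in ℚ.

  toℚᵘ-/ : ∀ i d .{{_ : ℕ.NonZero d}} → ℚ.toℚᵘ (i / d) ℚᵘ.≃ i ℚᵘ./ d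
  toℚᵘ-/ i (suc d) = ℚ.toℚᵘ-fromℚᵘ (ℚᵘ.mkℚᵘ i d)

  ι : ℤ → ℚ
  ι i = i / 1

  ι-homo-+ : ∀ i j → ι (i ℤ.+ j) ≡ ι i + ι j
  ι-homo-+ i j = ℚ.toℚᵘ-injective (begin
    ℚ.toℚᵘ (ι (i ℤ.+ j))           ≈⟨ toℚᵘ-/ (i ℤ.+ j) 1 ⟩
    (i ℤ.+ j) ℚᵘ./ 1               ≈⟨ ℚᵘ.*≡* (cong (ℤ._* + 1) (cong₂ ℤ._+_ (sym (ℤ.*-identityʳ i)) (sym (ℤ.*-identityʳ j)))) ⟩
    i ℚᵘ./ 1 ℚᵘ.+ j ℚᵘ./ 1         ≈⟨ ℚᵘ.+-cong (toℚᵘ-/ i 1) (toℚᵘ-/ j 1) ⟨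
    ℚ.toℚᵘ (ι i) ℚᵘ.+ ℚ.toℚᵘ (ι j) ≈⟨ ℚ.toℚᵘ-homo-+ (ι i) (ι j) ⟨
    ℚ.toℚᵘ (ι i + ι j)             ∎)
    where open ℚᵘ.≃-Reasoning

  ι-homo-* : ∀ i j → ι (i ℤ.* j) ≡ ι i * ι j
  ι-homo-* i j = ℚ.toℚᵘ-injective (begin
    ℚ.toℚᵘ (ι (i ℤ.* j))           ≈⟨ toℚᵘ-/ (i ℤ.* j) 1 ⟩
    (i ℤ.* j) ℚᵘ./ 1               ≈⟨ ℚᵘ.*≡* refl ⟩
    i ℚᵘ./ 1 ℚᵘ.* (j ℚᵘ./ 1)        ≈⟨ ℚᵘ.*-cong (toℚᵘ-/ i 1) (toℚᵘ-/ j 1) ⟨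
    ℚ.toℚᵘ (ι i) ℚᵘ.* ℚ.toℚᵘ (ι j) ≈⟨ ℚ.toℚᵘ-homo-* (ι i) (ι j) ⟨
    ℚ.toℚᵘ (ι i * ι j)             ∎)
    where open ℚᵘ.≃-Reasoning

  ι-mono-≤ : ∀ {i j} → i ℤ.≤ j → ι i ≤ ι j
  ι-mono-≤ {i} {j} i≤j = ℚ.toℚᵘ-cancel-≤ (begin
    ℚ.toℚᵘ (ι i) ≃⟨ toℚᵘ-/ i 1 ⟩
    i ℚᵘ./ 1     ≤⟨ ℚᵘ.*≤* (ℤ.*-monoʳ-≤-nonNeg (+ 1) i≤j) ⟩
    j ℚᵘ./ 1     ≃⟨ toℚᵘ-/ j 1 ⟨
    ℚ.toℚᵘ (ι j) ∎)
    where open ℚᵘ.≤-Reasoning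

  ι-cancel-≤ : ∀ {i j} → ι i ≤ ι j → i ℤ.≤ j
  ι-cancel-≤ {i} {j} ιi≤ιj = subst₂ ℤ._≤_ (ℤ.*-identityʳ i) (ℤ.*-identityʳ j)
    (ℚᵘ.drop-*≤* (begin
    i ℚᵘ./ 1     ≃⟨ toℚᵘ-/ i 1 ⟨
    ℚ.toℚᵘ (ι i) ≤⟨ ℚ.toℚᵘ-mono-≤ ιi≤ιj ⟩
    ℚ.toℚᵘ (ι j) ≃⟨ toℚᵘ-/ j 1 ⟩
    j ℚᵘ./ 1     ∎))
    where open ℚᵘ.≤-Reasoning

  -- `_/_` divides out a gcd that does not compute on variables. Multiplying back by the denominator
  -- is how fractions with variable denominators are handled from here on.
  /-*-cancel : ∀ i d .{{_ : ℕ.NonZero d}} → i / d * ι (+ d) ≡ ι i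
  /-*-cancel i d@(suc d-1) = ℚ.toℚᵘ-injective (begin
    ℚ.toℚᵘ (i / d * ι (+ d))              ≈⟨ ℚ.toℚᵘ-homo-* (i / d) (ι (+ d)) ⟩
    ℚ.toℚᵘ (i / d) ℚᵘ.* ℚ.toℚᵘ (ι (+ d))  ≈⟨ ℚᵘ.*-cong (toℚᵘ-/ i d) (toℚᵘ-/ (+ d) 1) ⟩
    i ℚᵘ./ d ℚᵘ.* (+ d ℚᵘ./ 1)            ≈⟨ ℚᵘ.*≡* (trans (ℤ.*-identityʳ (i ℤ.* + d))
                                               (cong (λ k → i ℤ.* + k) (sym (ℕ.*-identityʳ d)))) ⟩
    i ℚᵘ./ 1                              ≈⟨ toℚᵘ-/ i 1 ⟨
    ℚ.toℚᵘ (ι i)                          ∎)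
    where open ℚᵘ.≃-Reasoning

  -- The shape of a certificate: the remainder `r` is named explicitly, which turns an inequality
  -- into an identity for the ring solver.
  0≤⇒+-≤ : ∀ {p q r} → 0ℚ ≤ r → p + r ≡ q → p ≤ q
  0≤⇒+-≤ {p} {q} {r} 0≤r p+r≡q = begin
    p       ≡⟨ ℚ.+-identityʳ p ⟨
    p + 0ℚ  ≤⟨ ℚ.+-monoʳ-≤ p 0≤r ⟩
    p + r   ≡⟨ p+r≡q ⟩
    q       ∎
    where open ℚ.≤-Reasoning

  0<⇒+-< : ∀ {p q r} → 0ℚ < r → p + r ≡ q → p < q
  0<⇒+-< {p} {q} {r} 0<r p+r≡q = begin-strict
    p       ≡⟨ ℚ.+-identityʳ p ⟨
    p + 0ℚ  <⟨ ℚ.+-monoʳ-< p 0<r ⟩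
    p + r   ≡⟨ p+r≡q ⟩
    q       ∎
    where open ℚ.≤-Reasoning

  0≤+ : ∀ {p q} → 0ℚ ≤ p → 0ℚ ≤ q → 0ℚ ≤ p + q
  0≤+ = ℚ.+-mono-≤

  0≤* : ∀ {p q} → 0ℚ ≤ p → 0ℚ ≤ q → 0ℚ ≤ p * q
  0≤* {p} {q} 0≤p 0≤q = ℚ.nonNegative⁻¹ (p * q)
    {{ℚ.nonNeg*nonNeg⇒nonNeg p {{nonNegative 0≤p}} q {{nonNegative 0≤q}}}}

  0<* : ∀ {p q} → 0ℚ < p → 0ℚ < q → 0ℚ < p * q
  0<* {p} {q} 0<p 0<q = ℚ.positive⁻¹ (p * q)
    {{ℚ.pos*pos⇒pos p {{positive 0<p}} q {{positive 0<q}}}}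

  *-mono-≤ : ∀ {p q r s} → 0ℚ ≤ p → 0ℚ ≤ r → p ≤ q → r ≤ s → p * r ≤ q * s
  *-mono-≤ {p} {q} {r} {s} 0≤p 0≤r p≤q r≤s = ℚ.≤-trans
    (ℚ.*-monoˡ-≤-nonNeg p {{nonNegative 0≤p}} r≤s)
    (ℚ.*-monoʳ-≤-nonNeg s {{nonNegative (ℚ.≤-trans 0≤r r≤s)}} p≤q)

  *-cancelˡ-≤ : ∀ {p q r} → 0ℚ < r → r * p ≤ r * q → p ≤ q
  *-cancelˡ-≤ {r = r} 0<r = ℚ.*-cancelˡ-≤-pos r {{positive 0<r}}

  *-cancelˡ-≡ : ∀ {p q r} → 0ℚ < r → r * p ≡ r * q → p ≡ q
  *-cancelˡ-≡ 0<r eq = ℚ.≤-antisym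
    (*-cancelˡ-≤ 0<r (ℚ.≤-reflexive eq)) (*-cancelˡ-≤ 0<r (ℚ.≤-reflexive (sym eq)))

  0<ι : ∀ d .{{_ : ℕ.NonZero d}} → 0ℚ < ι (+ d)
  0<ι d = ℚ.positive⁻¹ (ι (+ d)) {{ℚ.normalize-pos d 1}}

  0</ : ∀ m n .{{_ : ℕ.NonZero m}} .{{_ : ℕ.NonZero n}} → 0ℚ < + m / n
  0</ m n = ℚ.positive⁻¹ (+ m / n) {{ℚ.normalize-pos m n}}

  0≤ι : ∀ n → 0ℚ ≤ ι (+ n)
  0≤ι n = ℚ.nonNegative⁻¹ (ι (+ n)) {{ℚ.normalize-nonNeg n 1}}

  -- Partial sums, Cauchy products and formal derivatives of coefficient sequences.

  ∑ : (ℕ → ℚ) → ℕ → ℚ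
  ∑ a zero    = 0ℚ
  ∑ a (suc n) = ∑ a n + a n

  NonNeg : (ℕ → ℚ) → Set
  NonNeg a = ∀ k → 0ℚ ≤ a k

  ∑-nonNeg : ∀ {a} → NonNeg a → NonNeg (∑ a)
  ∑-nonNeg 0≤a zero    = ℚ.≤-refl
  ∑-nonNeg 0≤a (suc n) = 0≤+ (∑-nonNeg 0≤a n) (0≤a n)

  ∑-monoʳ-≤ : ∀ {a} → NonNeg a → ∀ {m n} → m ℕ.≤ n → ∑ a m ≤ ∑ a n
  ∑-monoʳ-≤ {a} 0≤a m≤n = go (ℕ.≤⇒≤′ m≤n)
    where
    go : ∀ {m n} → m ℕ.≤′ n → ∑ a m ≤ ∑ a n
    go ℕ.≤′-refl         = ℚ.≤-refl
    go (ℕ.≤′-step {n} p) = ℚ.≤-trans (go p) (0≤⇒+-≤ (0≤a n) refl)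

  ∑-head : ∀ a n → ∑ a (suc n) ≡ a 0 + ∑ (a ∘ suc) n
  ∑-head a zero    = ℚ.+-comm 0ℚ (a 0)
  ∑-head a (suc n) = trans (cong (_+ a (suc n)) (∑-head a n))
    (ℚ.+-assoc (a 0) (∑ (a ∘ suc) n) (a (suc n)))

  infixl 7 _⊛_

  -- The Cauchy product Σ a i · b (k - i) over i ≤ k. Shifting `a` at each step avoids subtraction
  -- of indices.
  _⊛_ : (ℕ → ℚ) → (ℕ → ℚ) → ℕ → ℚ
  (a ⊛ b) zero    = a 0 * b 0
  (a ⊛ b) (suc k) = a 0 * b (suc k) + (a ∘ suc ⊛ b) k

  ⊛-nonNeg : ∀ {a b} → NonNeg a → NonNeg b → NonNeg (a ⊛ b)
  ⊛-nonNeg 0≤a 0≤b zero    = 0≤* (0≤a 0) (0≤b 0)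
  ⊛-nonNeg 0≤a 0≤b (suc k) =
    0≤+ (0≤* (0≤a 0) (0≤b (suc k))) (⊛-nonNeg (0≤a ∘ suc) 0≤b k)

  ⊛-cong : ∀ {a a′ b b′} → a ≗ a′ → b ≗ b′ → a ⊛ b ≗ a′ ⊛ b′
  ⊛-cong a≗ b≗ zero    = cong₂ _*_ (a≗ 0) (b≗ 0)
  ⊛-cong a≗ b≗ (suc k) =
    cong₂ _+_ (cong₂ _*_ (a≗ 0) (b≗ (suc k))) (⊛-cong (a≗ ∘ suc) b≗ k)

  ⊛-distribʳ-+ : ∀ a a′ b k → ((λ i → a i + a′ i) ⊛ b) k ≡ (a ⊛ b) k + (a′ ⊛ b) k
  ⊛-distribʳ-+ a a′ b zero    = ℚ.*-distribʳ-+ (b 0) (a 0) (a′ 0)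
  ⊛-distribʳ-+ a a′ b (suc k)
    rewrite ⊛-distribʳ-+ (a ∘ suc) (a′ ∘ suc) b k =
    solve 5 (λ a a′ b s t → (a :+ a′) :* b :+ (s :+ t) := (a :* b :+ s) :+ (a′ :* b :+ t))
      refl (a 0) (a′ 0) (b (suc k)) ((a ∘ suc ⊛ b) k) ((a′ ∘ suc ⊛ b) k)

  ⊛-scaleˡ : ∀ c a b k → ((λ i → c * a i) ⊛ b) k ≡ c * (a ⊛ b) k
  ⊛-scaleˡ c a b zero    = ℚ.*-assoc c (a 0) (b 0)
  ⊛-scaleˡ c a b (suc k) rewrite ⊛-scaleˡ c (a ∘ suc) b k =
    solve 4 (λ c a b s → c :* a :* b :+ c :* s := c :* (a :* b :+ s))
      refl c (a 0) (b (suc k)) ((a ∘ suc ⊛ b) k)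

  ⊛-scaleʳ : ∀ c a b k → (a ⊛ (λ i → c * b i)) k ≡ c * (a ⊛ b) k
  ⊛-scaleʳ c a b zero    =
    solve 3 (λ c a b → a :* (c :* b) := c :* (a :* b)) refl c (a 0) (b 0)
  ⊛-scaleʳ c a b (suc k) rewrite ⊛-scaleʳ c (a ∘ suc) b k =
    solve 4 (λ c a b s → a :* (c :* b) :+ c :* s := c :* (a :* b :+ s))
      refl c (a 0) (b (suc k)) ((a ∘ suc ⊛ b) k)

  -- The formal derivative of the power series with coefficients a.
  D : (ℕ → ℚ) → ℕ → ℚ
  D a k = ι (+ suc k) * a (suc k)

  ι-suc : ∀ n → ι (+ suc n) ≡ 1ℚ + ι (+ n)
  ι-suc n = ι-homo-+ (+ 1) (+ n)

  -- This is (X f)′ = X f′ + f, read off at one coefficient.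
  D-suc : ∀ a k → D a (suc k) ≡ D (a ∘ suc) k + a (suc (suc k))
  D-suc a k rewrite ι-suc (suc k) =
    solve 2 (λ i a → (con 1ℚ :+ i) :* a := i :* a :+ a) refl (ι (+ suc k)) (a (suc (suc k)))

  -- The Leibniz rule, by induction along the recursion of `_⊛_`. It allows `e-+` to go through a
  -- differential equation in place of binomial coefficients.
  D-⊛ : ∀ a b k → D (a ⊛ b) k ≡ (D a ⊛ b) k + (a ⊛ D b) k
  D-⊛ a b zero =
    solve 4 (λ a₀ a₁ b₀ b₁ → con 1ℚ :* (a₀ :* b₁ :+ a₁ :* b₀)
      := con 1ℚ :* a₁ :* b₀ :+ a₀ :* (con 1ℚ :* b₁)) refl (a 0) (a 1) (b 0) (b 1)
  D-⊛ a b (suc k) = begin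
    D (a ⊛ b) (suc k)
      ≡⟨ D-suc (a ⊛ b) k ⟩
    i * (a 0 * b₂ + (a′ ⊛ b) (suc k)) + (a 0 * b₂ + (a′ ⊛ b) (suc k))
      ≡⟨ solve 4 (λ i a b s → i :* (a :* b :+ s) :+ (a :* b :+ s)
           := a :* ((con 1ℚ :+ i) :* b) :+ s :+ i :* s) refl i (a 0) b₂ ((a′ ⊛ b) (suc k)) ⟩
    a 0 * ((1ℚ + i) * b₂) + (a′ ⊛ b) (suc k) + D (a′ ⊛ b) k
      ≡⟨ cong₂ _+_ (cong (λ j → a 0 * (j * b₂) + (a′ ⊛ b) (suc k)) (sym (ι-suc (suc k)))) (D-⊛ a′ b k) ⟩
    a 0 * D b (suc k) + (a 1 * b (suc k) + (a″ ⊛ b) k) + ((D a′ ⊛ b) k + (a′ ⊛ D b) k)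
      ≡⟨ solve 6 (λ u v w s t r → u :+ (v :* w :+ s) :+ (t :+ r)
           := con 1ℚ :* v :* w :+ (t :+ s) :+ (u :+ r)) refl
           (a 0 * D b (suc k)) (a 1) (b (suc k)) ((a″ ⊛ b) k) ((D a′ ⊛ b) k) ((a′ ⊛ D b) k) ⟩
    D a 0 * b (suc k) + ((D a′ ⊛ b) k + (a″ ⊛ b) k) + (a ⊛ D b) (suc k)
      ≡⟨ cong (λ s → D a 0 * b (suc k) + s + (a ⊛ D b) (suc k))
           (sym (trans (⊛-cong (D-suc a) (λ _ → refl) k) (⊛-distribʳ-+ (D a′) a″ b k))) ⟩
    (D a ⊛ b) (suc k) + (a ⊛ D b) (suc k) ∎
    where
    open ≡-Reasoning
    i  = ι (+ suc k)
    a′ = a ∘ suc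
    a″ = a′ ∘ suc
    b₂ = b (suc (suc k))

  -- The left side sums a i · b j over the triangle i + j ≤ n; the row i = 0 is split off.
  ∑-⊛-suc : ∀ a b n → ∑ (a ⊛ b) (suc n) ≡ a 0 * ∑ b (suc n) + ∑ (a ∘ suc ⊛ b) n
  ∑-⊛-suc a b zero =
    solve 2 (λ a b → con 0ℚ :+ a :* b := a :* (con 0ℚ :+ b) :+ con 0ℚ) refl (a 0) (b 0)
  ∑-⊛-suc a b (suc n) rewrite ∑-⊛-suc a b n =
    solve 5 (λ a s t b u → a :* s :+ t :+ (a :* b :+ u) := a :* (s :+ b) :+ (t :+ u)) refl
      (a 0) (∑ b (suc n)) (∑ (a ∘ suc ⊛ b) n) (b (suc n)) ((a ∘ suc ⊛ b) n)

  -- The triangle i + j < n lies in the rectangle i < n, j < m as soon as n ≤ m, and all terms are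
  -- nonnegative.
  ∑-⊛-≤ : ∀ {a b} → NonNeg a → NonNeg b → ∀ {n m} → n ℕ.≤ m →
          ∑ (a ⊛ b) n ≤ ∑ a n * ∑ b m
  ∑-⊛-≤ {b = b} 0≤a 0≤b {zero} {m} _ = ℚ.≤-reflexive (sym (ℚ.*-zeroˡ (∑ b m)))
  ∑-⊛-≤ {a} {b} 0≤a 0≤b {suc n} {m} n<m = begin
    ∑ (a ⊛ b) (suc n)                           ≡⟨ ∑-⊛-suc a b n ⟩
    a 0 * ∑ b (suc n) + ∑ (a ∘ suc ⊛ b) n
      ≤⟨ ℚ.+-mono-≤ (ℚ.*-monoˡ-≤-nonNeg (a 0) {{nonNegative (0≤a 0)}} (∑-monoʳ-≤ 0≤b n<m))
                    (∑-⊛-≤ (0≤a ∘ suc) 0≤b (ℕ.<⇒≤ n<m)) ⟩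
    a 0 * ∑ b m + ∑ (a ∘ suc) n * ∑ b m         ≡⟨ ℚ.*-distribʳ-+ (∑ b m) (a 0) (∑ (a ∘ suc) n) ⟨
    (a 0 + ∑ (a ∘ suc) n) * ∑ b m               ≡⟨ cong (_* ∑ b m) (∑-head a n) ⟨
    ∑ a (suc n) * ∑ b m                         ∎
    where open ℚ.≤-Reasoning

  -- Conversely, the rectangle i < n, j < m lies in the triangle i + j < n + m.
  ≤-∑-⊛ : ∀ {a b} → NonNeg a → NonNeg b → ∀ n m →
          ∑ a n * ∑ b m ≤ ∑ (a ⊛ b) (n ℕ.+ m)
  ≤-∑-⊛ {b = b} 0≤a 0≤b zero m = ℚ.≤-trans (ℚ.≤-reflexive (ℚ.*-zeroˡ (∑ b m)))
    (∑-nonNeg (⊛-nonNeg 0≤a 0≤b) m)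
  ≤-∑-⊛ {a} {b} 0≤a 0≤b (suc n) m = begin
    ∑ a (suc n) * ∑ b m                         ≡⟨ cong (_* ∑ b m) (∑-head a n) ⟩
    (a 0 + ∑ (a ∘ suc) n) * ∑ b m               ≡⟨ ℚ.*-distribʳ-+ (∑ b m) (a 0) (∑ (a ∘ suc) n) ⟩
    a 0 * ∑ b m + ∑ (a ∘ suc) n * ∑ b m
      ≤⟨ ℚ.+-mono-≤ (ℚ.*-monoˡ-≤-nonNeg (a 0) {{nonNegative (0≤a 0)}} (∑-monoʳ-≤ 0≤b (ℕ.m≤n+m m (suc n))))
                    (≤-∑-⊛ (0≤a ∘ suc) 0≤b n m) ⟩
    a 0 * ∑ b (suc (n ℕ.+ m)) + ∑ (a ∘ suc ⊛ b) (n ℕ.+ m) ≡⟨ ∑-⊛-suc a b (n ℕ.+ m) ⟨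
    ∑ (a ⊛ b) (suc n ℕ.+ m)                     ∎
    where open ℚ.≤-Reasoning

  -- The truncated exponential series and its functional equation.

  1/! : ℕ → ℚ
  1/! k = (+ 1 / (k !)) {{k ℕ.!≢0}}

  1/!-suc : ∀ k → ι (+ suc k) * 1/! (suc k) ≡ 1/! k
  1/!-suc k = *-cancelˡ-≡ (0<ι (k !) {{k ℕ.!≢0}}) (begin
    ι (+ (k !)) * (ι (+ suc k) * 1/! (suc k))
      ≡⟨ solve 3 (λ f s g → f :* (s :* g) := g :* (s :* f)) refl (ι (+ (k !))) (ι (+ suc k)) (1/! (suc k)) ⟩
    1/! (suc k) * (ι (+ suc k) * ι (+ (k !)))
      ≡⟨ cong (1/! (suc k) *_) (trans (cong ι (ℤ.pos-* (suc k) (k !))) (ι-homo-* (+ suc k) (+ (k !)))) ⟨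
    1/! (suc k) * ι (+ (suc k !))   ≡⟨ /-*-cancel (+ 1) (suc k !) {{suc k ℕ.!≢0}} ⟩
    1ℚ                            ≡⟨ /-*-cancel (+ 1) (k !) {{k ℕ.!≢0}} ⟨
    1/! k * ι (+ (k !))             ≡⟨ ℚ.*-comm (1/! k) (ι (+ (k !))) ⟩
    ι (+ (k !)) * 1/! k             ∎)
    where open ≡-Reasoning

  0≤1/! : ∀ k → 0ℚ ≤ 1/! k
  0≤1/! k = ℚ.<⇒≤ (0</ 1 (k !) {{_}} {{k ℕ.!≢0}})

  ^-nonNeg : ∀ {x} → 0ℚ ≤ x → ∀ k → 0ℚ ≤ x ^ k
  ^-nonNeg 0≤x zero    = 0≤ι 1
  ^-nonNeg 0≤x (suc k) = 0≤* 0≤x (^-nonNeg 0≤x k)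

  ^-monoˡ-≤ : ∀ {x y} → 0ℚ ≤ x → x ≤ y → ∀ k → x ^ k ≤ y ^ k
  ^-monoˡ-≤ 0≤x x≤y zero    = ℚ.≤-refl
  ^-monoˡ-≤ 0≤x x≤y (suc k) = *-mono-≤ 0≤x (^-nonNeg 0≤x k) x≤y (^-monoˡ-≤ 0≤x x≤y k)

  e : ℚ → ℕ → ℚ
  e x k = 1/! k * x ^ k

  e-nonNeg : ∀ {x} → 0ℚ ≤ x → NonNeg (e x)
  e-nonNeg 0≤x k = 0≤* (0≤1/! k) (^-nonNeg 0≤x k)

  e-monoˡ-≤ : ∀ {x y} → 0ℚ ≤ x → x ≤ y → ∀ k → e x k ≤ e y k
  e-monoˡ-≤ 0≤x x≤y k =
    ℚ.*-monoˡ-≤-nonNeg (1/! k) {{nonNegative (0≤1/! k)}} (^-monoˡ-≤ 0≤x x≤y k)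

  D-e : ∀ x k → D (e x) k ≡ x * e x k
  D-e x k = begin
    ι (+ suc k) * (1/! (suc k) * (x * x ^ k))
      ≡⟨ solve 4 (λ i f x y → i :* (f :* (x :* y)) := x :* (i :* f :* y)) refl
           (ι (+ suc k)) (1/! (suc k)) x (x ^ k) ⟩
    x * (ι (+ suc k) * 1/! (suc k) * x ^ k)
      ≡⟨ cong (λ f → x * (f * x ^ k)) (1/!-suc k) ⟩
    x * e x k ∎
    where open ≡-Reasoning

  -- Both sides solve a′ = (x + y) a with a 0 = 1.
  e-+ : ∀ x y → e x ⊛ e y ≗ e (x + y)
  e-+ x y zero    = refl
  e-+ x y (suc k) = *-cancelˡ-≡ (0<ι (suc k)) (begin
    D (e x ⊛ e y) k                                          ≡⟨ D-⊛ (e x) (e y) k ⟩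
    (D (e x) ⊛ e y) k + (e x ⊛ D (e y)) k
      ≡⟨ cong₂ _+_ (⊛-cong (D-e x) (λ _ → refl) k) (⊛-cong {a = e x} (λ _ → refl) (D-e y) k) ⟩
    ((λ i → x * e x i) ⊛ e y) k + (e x ⊛ (λ i → y * e y i)) k
      ≡⟨ cong₂ _+_ (⊛-scaleˡ x (e x) (e y) k) (⊛-scaleʳ y (e x) (e y) k) ⟩
    x * (e x ⊛ e y) k + y * (e x ⊛ e y) k                    ≡⟨ ℚ.*-distribʳ-+ ((e x ⊛ e y) k) x y ⟨
    (x + y) * (e x ⊛ e y) k                                  ≡⟨ cong ((x + y) *_) (e-+ x y k) ⟩
    (x + y) * e (x + y) k                                    ≡⟨ D-e (x + y) k ⟨
    D (e (x + y)) k                                          ∎)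
    where open ≡-Reasoning

  ∑-cong : ∀ {a b} → a ≗ b → ∑ a ≗ ∑ b
  ∑-cong a≗b zero    = refl
  ∑-cong a≗b (suc n) = cong₂ _+_ (∑-cong a≗b n) (a≗b n)

  E : ℚ → ℕ → ℚ
  E x = ∑ (e x)

  E-nonNeg : ∀ {x} → 0ℚ ≤ x → NonNeg (E x)
  E-nonNeg = ∑-nonNeg ∘ e-nonNeg

  E-+-≤ : ∀ {x y} → 0ℚ ≤ x → 0ℚ ≤ y → ∀ n → E (x + y) n ≤ E x n * E y n
  E-+-≤ {x} {y} 0≤x 0≤y n = ℚ.≤-trans (ℚ.≤-reflexive (sym (∑-cong (e-+ x y) n)))
    (∑-⊛-≤ (e-nonNeg 0≤x) (e-nonNeg 0≤y) {n} ℕ.≤-refl)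

  ≤-E-+ : ∀ {x y} → 0ℚ ≤ x → 0ℚ ≤ y → ∀ n m → E x n * E y m ≤ E (x + y) (n ℕ.+ m)
  ≤-E-+ {x} {y} 0≤x 0≤y n m = ℚ.≤-trans (≤-∑-⊛ (e-nonNeg 0≤x) (e-nonNeg 0≤y) n m)
    (ℚ.≤-reflexive (∑-cong (e-+ x y) (n ℕ.+ m)))

  ι-suc-* : ∀ k x → ι (+ suc k) * x ≡ x + ι (+ k) * x
  ι-suc-* k x rewrite ι-suc k =
    solve 2 (λ i x → (con 1ℚ :+ i) :* x := x :+ i :* x) refl (ι (+ k)) x

  -- Lower half of the squeeze that identifies the limit of Eₙ(x)ᵏ; `≤-E-*` is the upper half, at
  -- the price of a longer truncation.
  E-*-≤ : ∀ {x} → 0ℚ ≤ x → ∀ k n → E (ι (+ suc k) * x) n ≤ E x n ^ suc k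
  E-*-≤ {x} 0≤x zero n = ℚ.≤-reflexive
    (trans (cong (λ y → E y n) (ℚ.*-identityˡ x)) (sym (ℚ.*-identityʳ (E x n))))
  E-*-≤ {x} 0≤x (suc k) n = begin
    E (ι (+ suc (suc k)) * x) n       ≡⟨ cong (λ y → E y n) (ι-suc-* (suc k) x) ⟩
    E (x + ι (+ suc k) * x) n         ≤⟨ E-+-≤ 0≤x (0≤* (0≤ι (suc k)) 0≤x) n ⟩
    E x n * E (ι (+ suc k) * x) n
      ≤⟨ ℚ.*-monoˡ-≤-nonNeg (E x n) {{nonNegative (E-nonNeg 0≤x n)}} (E-*-≤ 0≤x k n) ⟩
    E x n ^ suc (suc k)               ∎
    where open ℚ.≤-Reasoning

  ≤-E-* : ∀ {x} → 0ℚ ≤ x → ∀ k n → E x n ^ suc k ≤ E (ι (+ suc k) * x) (suc k ℕ.* n)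
  ≤-E-* {x} 0≤x zero n = ℚ.≤-reflexive
    (trans (ℚ.*-identityʳ (E x n)) (sym (cong₂ E (ℚ.*-identityˡ x) (ℕ.*-identityˡ n))))
  ≤-E-* {x} 0≤x (suc k) n = begin
    E x n ^ suc (suc k)
      ≤⟨ ℚ.*-monoˡ-≤-nonNeg (E x n) {{nonNegative (E-nonNeg 0≤x n)}} (≤-E-* 0≤x k n) ⟩
    E x n * E (ι (+ suc k) * x) (suc k ℕ.* n)  ≤⟨ ≤-E-+ 0≤x (0≤* (0≤ι (suc k)) 0≤x) n (suc k ℕ.* n) ⟩
    E (x + ι (+ suc k) * x) (suc (suc k) ℕ.* n) ≡⟨ cong (λ y → E y (suc (suc k) ℕ.* n)) (ι-suc-* (suc k) x) ⟨
    E (ι (+ suc (suc k)) * x) (suc (suc k) ℕ.* n) ∎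
    where open ℚ.≤-Reasoning

  -- Termwise comparison: each term added at `x` is at most the one added at `y`. A Cauchy modulus
  -- for the series at `y` therefore also serves at `x`.
  E-diff-≤ : ∀ {x y} → 0ℚ ≤ x → x ≤ y → ∀ {m n} → m ℕ.≤ n → E x n - E x m ≤ E y n - E y m
  E-diff-≤ {x} {y} 0≤x x≤y {m} m≤n = go (ℕ.≤⇒≤′ m≤n)
    where
    open ℚ.≤-Reasoning
    shift : ∀ a b c → (a + b) - c ≡ (a - c) + b
    shift = solve 3 (λ a b c → (a :+ b) :- c := (a :- c) :+ b) refl
    go : ∀ {n} → m ℕ.≤′ n → E x n - E x m ≤ E y n - E y m
    go ℕ.≤′-refl         = ℚ.≤-reflexive (trans (ℚ.+-inverseʳ (E x m)) (sym (ℚ.+-inverseʳ (E y m))))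
    go (ℕ.≤′-step {n} p) = begin
      E x n + e x n - E x m   ≡⟨ shift (E x n) (e x n) (E x m) ⟩
      E x n - E x m + e x n   ≤⟨ ℚ.+-mono-≤ (go p) (e-monoˡ-≤ 0≤x x≤y n) ⟩
      E y n - E y m + e y n   ≡⟨ shift (E y n) (e y n) (E y m) ⟨
      E y n + e y n - E y m   ∎

  -- Polynomial inequalities for the truncated series.

  -- Coefficientwise, (2 - x) eˣ = 2 + x - Σ_{k ≥ 3} (k - 2) xᵏ / k!; the last term
  -- on the left is what remains of the truncated series.
  E-upper′ : ∀ {x} → 0ℚ ≤ x → ∀ n →
             (ι (+ 2) - x) * E x (2 ℕ.+ n) + x * e x (suc n) ≤ ι (+ 2) + x
  E-upper′ {x} 0≤x zero = ℚ.≤-reflexive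
    (solve 1 (λ x → (con (ι (+ 2)) :- x) :* (con 0ℚ :+ con 1ℚ :* con 1ℚ :+ con 1ℚ :* (x :* con 1ℚ))
      :+ x :* (con 1ℚ :* (x :* con 1ℚ)) := con (ι (+ 2)) :+ x) refl x)
  E-upper′ {x} 0≤x (suc n) = ℚ.≤-trans (0≤⇒+-≤ {r = ι (+ n) * e₂} (0≤* (0≤ι n) (e-nonNeg 0≤x (2 ℕ.+ n))) (begin
    (ι (+ 2) - x) * (s + e₂) + x * e₂ + ι (+ n) * e₂
      ≡⟨ solve 4 (λ x s e i → (con (ι (+ 2)) :- x) :* (s :+ e) :+ x :* e :+ i :* e
           := (con (ι (+ 2)) :- x) :* s :+ (con 1ℚ :+ (con 1ℚ :+ i)) :* e) refl x s e₂ (ι (+ n)) ⟩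
    (ι (+ 2) - x) * s + (1ℚ + (1ℚ + ι (+ n))) * e₂
      ≡⟨ cong (λ i → (ι (+ 2) - x) * s + i * e₂) (trans (ι-suc (suc n)) (cong (λ i → 1ℚ + i) (ι-suc n))) ⟨
    (ι (+ 2) - x) * s + ι (+ suc (suc n)) * e₂
      ≡⟨ cong (λ i → (ι (+ 2) - x) * s + i) (D-e x (suc n)) ⟩
    (ι (+ 2) - x) * s + x * e x (suc n) ∎))
    (E-upper′ 0≤x n)
    where
    open ≡-Reasoning
    s  = E x (2 ℕ.+ n)
    e₂ = e x (2 ℕ.+ n)

  E-upper : ∀ {x} → 0ℚ ≤ x → ∀ n → (ι (+ 2) - x) * E x (2 ℕ.+ n) ≤ ι (+ 2) + x
  E-upper {x} 0≤x n = ℚ.≤-trans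
    (0≤⇒+-≤ (0≤* 0≤x (e-nonNeg 0≤x (suc n))) refl) (E-upper′ 0≤x n)

  -- 12 - 6x + x² = 12x (1/x - 1/2 + x/12), so this is 1 / (eˣ - 1) < 1/x - 1/2 + x/12.
  -- Truncating at degree 6 leaves only nonnegative coefficients in the remainder.
  E-lower : ∀ {x} → 0ℚ < x → ι (+ 12) * x < (ι (+ 12) - ι (+ 6) * x + x * x) * (E x 7 - 1ℚ)
  E-lower {x} 0<x = 0<⇒+-< {r = x⁵ * (+ 1 / 60 + + 1 / 120 * x + + 1 / 720 * (x * (x * x)))}
    (0<* (0<* 0<x (0<* 0<x (0<* 0<x (0<* 0<x 0<x))))
      (ℚ.+-mono-<-≤ {0ℚ} {_} {0ℚ} (ℚ.+-mono-<-≤ {0ℚ} {_} {0ℚ} (0</ 1 60) (0≤* (ℚ.<⇒≤ (0</ 1 120)) (ℚ.<⇒≤ 0<x)))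
      (ℚ.<⇒≤ (0<* (0</ 1 720) (0<* 0<x (0<* 0<x 0<x))))))
    (solve 1 (λ x →
      con (ι (+ 12)) :* x :+ (x :* (x :* (x :* (x :* x))))
        :* (con (+ 1 / 60) :+ con (+ 1 / 120) :* x :+ con (+ 1 / 720) :* (x :* (x :* x)))
      := (con (ι (+ 12)) :- con (ι (+ 6)) :* x :+ x :* x) :*
       (con 0ℚ :+ con 1ℚ :* con 1ℚ :+ con 1ℚ :* (x :* con 1ℚ) :+ con ½ :* (x :* (x :* con 1ℚ))
        :+ con (+ 1 / 6) :* (x :* (x :* (x :* con 1ℚ)))
        :+ con (+ 1 / 24) :* (x :* (x :* (x :* (x :* con 1ℚ))))
        :+ con (+ 1 / 120) :* (x :* (x :* (x :* (x :* (x :* con 1ℚ)))))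
        :+ con (+ 1 / 720) :* (x :* (x :* (x :* (x :* (x :* (x :* con 1ℚ))))))
        :- con 1ℚ)) refl x)
    where x⁵ = x * (x * (x * (x * x)))

  -- Distances and reciprocals in ℚ.

  p≤∣p∣ : ∀ p → p ≤ ∣ p ∣
  p≤∣p∣ p with ℚ.≤-total 0ℚ p
  ... | inj₁ 0≤p = ℚ.≤-reflexive (sym (ℚ.0≤p⇒∣p∣≡p 0≤p))
  ... | inj₂ p≤0 = ℚ.≤-trans p≤0 (ℚ.0≤∣p∣ p)

  neg-minus : ∀ p q → ℚ.- (p - q) ≡ q - p
  neg-minus = solve 2 (λ p q → :- (p :- q) := q :- p) refl

  ∣p-q∣≡∣q-p∣ : ∀ p q → ∣ p - q ∣ ≡ ∣ q - p ∣
  ∣p-q∣≡∣q-p∣ p q = trans (sym (ℚ.∣-p∣≡∣p∣ (p - q))) (cong ∣_∣ (neg-minus p q))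

  ∣p-q∣< : ∀ {p q ε} → p - q < ε → q - p < ε → ∣ p - q ∣ < ε
  ∣p-q∣< {p} {q} {ε} p-q<ε q-p<ε with ℚ.∣p∣≡p∨∣p∣≡-p (p - q)
  ... | inj₁ eq = subst (_< ε) (sym eq) p-q<ε
  ... | inj₂ eq = subst (_< ε) (sym (trans eq (neg-minus p q))) q-p<ε

  p-q<∣∣ : ∀ {p q ε} → ∣ p - q ∣ < ε → p - q < ε
  p-q<∣∣ {p} {q} = ℚ.≤-<-trans (p≤∣p∣ (p - q))

  close-sym : ∀ {p q ε} → ∣ p - q ∣ < ε → ∣ q - p ∣ < ε
  close-sym {p} {q} {ε} = subst (_< ε) (∣p-q∣≡∣q-p∣ p q)

  close-trans : ∀ {p q r δ η} → ∣ p - q ∣ < δ → ∣ q - r ∣ < η → ∣ p - r ∣ < δ + η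
  close-trans {p} {q} {r} {δ} {η} p~q q~r = begin-strict
    ∣ p - r ∣               ≡⟨ cong ∣_∣ (solve 3 (λ p q r → p :- r := (p :- q) :+ (q :- r)) refl p q r) ⟩
    ∣ (p - q) + (q - r) ∣   ≤⟨ ℚ.∣p+q∣≤∣p∣+∣q∣ (p - q) (q - r) ⟩
    ∣ p - q ∣ + ∣ q - r ∣   <⟨ ℚ.+-mono-< p~q q~r ⟩
    δ + η                   ∎
    where open ℚ.≤-Reasoning

  close-squeeze : ∀ {a y b t ε} → a ≤ y → y ≤ b → ∣ a - t ∣ < ε → ∣ b - t ∣ < ε → ∣ y - t ∣ < ε
  close-squeeze {a} {y} {b} {t} a≤y y≤b a~t b~t = ∣p-q∣< {y} {t}
    (ℚ.≤-<-trans (ℚ.+-monoˡ-≤ (ℚ.- t) y≤b) (p-q<∣∣ {b} b~t))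
    (ℚ.≤-<-trans (ℚ.+-monoʳ-≤ t (ℚ.neg-antimono-≤ a≤y)) (p-q<∣∣ {t} (close-sym {a} a~t)))

  ½+½ : ∀ ε → ½ * ε + ½ * ε ≡ ε
  ½+½ = solve 1 (λ ε → con ½ :* ε :+ con ½ :* ε := ε) refl

  0<½* : ∀ {ε} → 0ℚ < ε → 0ℚ < ½ * ε
  0<½* = 0<* (0</ 1 2)

  recip : ∀ {p} → 0ℚ < p → ℚ
  recip {p} 0<p = (1/ p) {{ℚ.>-nonZero 0<p}}

  *-recip : ∀ {p} (0<p : 0ℚ < p) → p * recip 0<p ≡ 1ℚ
  *-recip {p} 0<p = ℚ.*-inverseʳ p {{ℚ.>-nonZero 0<p}}

  recip-antimono-≤ : ∀ {p q} (0<p : 0ℚ < p) (0<q : 0ℚ < q) → p ≤ q → recip 0<q ≤ recip 0<p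
  recip-antimono-≤ {p} {q} 0<p 0<q p≤q = *-cancelˡ-≤ (0<* 0<p 0<q) (begin
    p * q * recip 0<q     ≡⟨ ℚ.*-assoc p q (recip 0<q) ⟩
    p * (q * recip 0<q)   ≡⟨ cong (p *_) (*-recip 0<q) ⟩
    p * 1ℚ                ≡⟨ ℚ.*-identityʳ p ⟩
    p                     ≤⟨ p≤q ⟩
    q                     ≡⟨ ℚ.*-identityʳ q ⟨
    q * 1ℚ                ≡⟨ cong (q *_) (*-recip 0<p) ⟨
    q * (p * recip 0<p)   ≡⟨ solve 3 (λ p q r → q :* (p :* r) := p :* q :* r) refl p q (recip 0<p) ⟩
    p * q * recip 0<p     ∎)
    where open ℚ.≤-Reasoning

  recip-minus : ∀ {p q} (0<p : 0ℚ < p) (0<q : 0ℚ < q) →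
                p * q * (recip 0<p - recip 0<q) ≡ q - p
  recip-minus {p} {q} 0<p 0<q = begin
    p * q * (recip 0<p - recip 0<q)
      ≡⟨ solve 4 (λ p q r s → p :* q :* (r :- s) := q :* (p :* r) :- p :* (q :* s)) refl
           p q (recip 0<p) (recip 0<q) ⟩
    q * (p * recip 0<p) - p * (q * recip 0<q)
      ≡⟨ cong₂ (λ u v → q * u - p * v) (*-recip 0<p) (*-recip 0<q) ⟩
    q * 1ℚ - p * 1ℚ
      ≡⟨ cong₂ _-_ (ℚ.*-identityʳ q) (ℚ.*-identityʳ p) ⟩
    q - p ∎
    where open ≡-Reasoning

  -- From 1/p - 1/q = (q - p)/(pq) and pq ≥ b².
  recip-close : ∀ {b p q ε} → 0ℚ < b → b ≤ p → b ≤ q → (0<p : 0ℚ < p) (0<q : 0ℚ < q) →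
                0ℚ < ε → ∣ p - q ∣ < b * b * ε → ∣ recip 0<p - recip 0<q ∣ < ε
  recip-close {b} {p} {q} {ε} 0<b b≤p b≤q 0<p 0<q 0<ε p~q =
    ℚ.*-cancelˡ-<-nonNeg (p * q) {{nonNegative (ℚ.<⇒≤ (0<* 0<p 0<q))}} (begin-strict
    p * q * ∣ recip 0<p - recip 0<q ∣
      ≡⟨ cong (_* ∣ recip 0<p - recip 0<q ∣) (ℚ.0≤p⇒∣p∣≡p (ℚ.<⇒≤ (0<* 0<p 0<q))) ⟨
    ∣ p * q ∣ * ∣ recip 0<p - recip 0<q ∣  ≡⟨ ℚ.∣p*q∣≡∣p∣*∣q∣ (p * q) (recip 0<p - recip 0<q) ⟨
    ∣ p * q * (recip 0<p - recip 0<q) ∣    ≡⟨ cong ∣_∣ (recip-minus 0<p 0<q) ⟩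
    ∣ q - p ∣                              <⟨ close-sym {p} p~q ⟩
    b * b * ε
      ≤⟨ ℚ.*-monoʳ-≤-nonNeg ε {{nonNegative (ℚ.<⇒≤ 0<ε)}}
           (*-mono-≤ (ℚ.<⇒≤ 0<b) (ℚ.<⇒≤ 0<b) b≤p b≤q) ⟩
    p * q * ε                              ∎)
    where open ℚ.≤-Reasoning

  E-close-≥ : ∀ {x y} → 0ℚ ≤ x → x ≤ y → ∀ {m n ε} → m ℕ.≤ n → ∣ E y n - E y m ∣ < ε → ∣ E x n - E x m ∣ < ε
  E-close-≥ {x} {y} 0≤x x≤y {m} {n} {ε} m≤n y~ = begin-strict
    ∣ E x n - E x m ∣   ≡⟨ ℚ.0≤p⇒∣p∣≡p (ℚ.≤-trans (ℚ.≤-reflexive (sym (ℚ.+-inverseʳ (E x m))))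
                            (ℚ.+-monoˡ-≤ (ℚ.- E x m) (∑-monoʳ-≤ (e-nonNeg 0≤x) m≤n))) ⟩
    E x n - E x m       ≤⟨ E-diff-≤ 0≤x x≤y m≤n ⟩
    E y n - E y m       ≤⟨ p≤∣p∣ (E y n - E y m) ⟩
    ∣ E y n - E y m ∣   <⟨ y~ ⟩
    ε                   ∎
    where open ℚ.≤-Reasoning

  E-close : ∀ {x y} → 0ℚ ≤ x → x ≤ y → ∀ m n {ε} →
            ∣ E y m - E y n ∣ < ε → ∣ E x m - E x n ∣ < ε
  E-close {x} {y} 0≤x x≤y m n {ε} y~ with ℕ.≤-total m n
  ... | inj₁ m≤n = close-sym {E x n} (E-close-≥ 0≤x x≤y m≤n (close-sym {E y m} y~))
  ... | inj₂ n≤m = E-close-≥ 0≤x x≤y n≤m y~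

  -- Two-sided bounds on the truncated 1/(eˣ - 1).

  module Bounds {x y} (0<x : 0ℚ < x) (xy≡1 : x * y ≡ 1ℚ) where
    private 0≤x = ℚ.<⇒≤ 0<x

    -- With at least two terms every truncation contains 1 + x, so `x` is a common positive lower
    -- bound and all the reciprocals exist.
    d : ℕ → ℚ
    d n = E x (2 ℕ.+ n) - 1ℚ

    d-mono-≤ : ∀ {m n} → m ℕ.≤ n → d m ≤ d n
    d-mono-≤ m≤n = ℚ.+-monoˡ-≤ (ℚ.- 1ℚ) (∑-monoʳ-≤ (e-nonNeg 0≤x) (ℕ.s≤s (ℕ.s≤s m≤n)))

    x≤d : ∀ n → x ≤ d n
    x≤d n = ℚ.≤-trans
      (ℚ.≤-reflexive (solve 1 (λ x → x := con 0ℚ :+ con 1ℚ :* con 1ℚ :+ con 1ℚ :* (x :* con 1ℚ) :- con 1ℚ) refl x))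
      (d-mono-≤ {0} {n} ℕ.z≤n)

    0<d : ∀ n → 0ℚ < d n
    0<d n = ℚ.<-≤-trans 0<x (x≤d n)

    -- Multiplied by 2x · `d n` and simplified with xy = 1, this is `E-upper` with 2 - x subtracted
    -- from both sides.
    y-½≤recip-d : ∀ n → y - ½ ≤ recip (0<d n)
    y-½≤recip-d n = *-cancelˡ-≤ (0<* (0<* (0</ 2 1) 0<x) (0<d n)) (begin
      ι (+ 2) * x * d n * (y - ½)
        ≡⟨ solve 3 (λ x y s → con (ι (+ 2)) :* x :* (s :- con 1ℚ) :* (y :- con ½)
             := (con (ι (+ 2)) :* (x :* y) :- x) :* s :- (con (ι (+ 2)) :* (x :* y) :- x))
             refl x y (E x (2 ℕ.+ n)) ⟩
      (ι (+ 2) * (x * y) - x) * E x (2 ℕ.+ n) - (ι (+ 2) * (x * y) - x)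
        ≡⟨ cong (λ t → (t - x) * E x (2 ℕ.+ n) - (t - x)) (cong (ι (+ 2) *_) xy≡1) ⟩
      (ι (+ 2) - x) * E x (2 ℕ.+ n) - (ι (+ 2) - x)
        ≤⟨ ℚ.+-monoˡ-≤ (ℚ.- (ι (+ 2) - x)) (E-upper 0≤x n) ⟩
      ι (+ 2) + x - (ι (+ 2) - x)
        ≡⟨ solve 1 (λ x → con (ι (+ 2)) :+ x :- (con (ι (+ 2)) :- x) := con (ι (+ 2)) :* x :* con 1ℚ) refl x ⟩
      ι (+ 2) * x * 1ℚ
        ≡⟨ cong (ι (+ 2) * x *_) (*-recip (0<d n)) ⟨
      ι (+ 2) * x * (d n * recip (0<d n))
        ≡⟨ ℚ.*-assoc (ι (+ 2) * x) (d n) (recip (0<d n)) ⟨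
      ι (+ 2) * x * d n * recip (0<d n) ∎)
      where open ℚ.≤-Reasoning

    -- Index 5 means seven terms, that is degree 6. Truncating at degree N leaves the coefficient (N
    -- - 6)/N! at x^(N+1) in the product of `E-lower`, so 6 is the least degree at which it is not
    -- negative.
    recip-d<y-½+x/12 : recip (0<d 5) < y - ½ + (+ 1 / 12) * x
    recip-d<y-½+x/12 = ℚ.*-cancelˡ-<-nonNeg (ι (+ 12) * x * d 5)
      {{nonNegative (ℚ.<⇒≤ (0<* (0<* (0</ 12 1) 0<x) (0<d 5)))}} (begin-strict
      ι (+ 12) * x * d 5 * recip (0<d 5)
        ≡⟨ ℚ.*-assoc (ι (+ 12) * x) (d 5) (recip (0<d 5)) ⟩
      ι (+ 12) * x * (d 5 * recip (0<d 5))
        ≡⟨ cong (ι (+ 12) * x *_) (*-recip (0<d 5)) ⟩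
      ι (+ 12) * x * 1ℚ
        ≡⟨ ℚ.*-identityʳ (ι (+ 12) * x) ⟩
      ι (+ 12) * x
        <⟨ E-lower 0<x ⟩
      (ι (+ 12) - ι (+ 6) * x + x * x) * d 5
        ≡⟨ cong (λ t → (t - ι (+ 6) * x + x * x) * d 5) (cong (ι (+ 12) *_) xy≡1) ⟨
      (ι (+ 12) * (x * y) - ι (+ 6) * x + x * x) * d 5
        ≡⟨ solve 3 (λ x y d → (con (ι (+ 12)) :* (x :* y) :- con (ι (+ 6)) :* x :+ x :* x) :* d
             := con (ι (+ 12)) :* x :* d :* (y :- con ½ :+ con (+ 1 / 12) :* x)) refl x y (d 5) ⟩
      ι (+ 12) * x * d 5 * (y - ½ + (+ 1 / 12) * x) ∎)
      where open ℚ.≤-Reasoning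

  -- Integer rounding of n / log θ - 1/2.

  module Rounding (p q n : ℕ) .{{_ : ℕ.NonZero p}} .{{_ : ℕ.NonZero q}} .{{_ : ℕ.NonZero n}}
    (p²≤n6q : p ℕ.* p ℕ.≤ n ℕ.* (6 ℕ.* q)) where
    private
      instance _ = ℕ.m*n≢0 2 p

    L x y : ℚ
    L = + p / q
    x = L * (+ 1 / n)
    y = ι (+ n) * (+ q / p)

    0<x : 0ℚ < x
    0<x = 0<* (0</ p q) (0</ 1 n)

    n*x≡L : ι (+ n) * x ≡ L
    n*x≡L = trans (solve 3 (λ n L i → n :* (L :* i) := L :* (i :* n)) refl (ι (+ n)) L (+ 1 / n))
      (trans (cong (L *_) (/-*-cancel (+ 1) n)) (ℚ.*-identityʳ L))

    private
      P Q N : ℚ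
      P = ι (+ p)
      Q = ι (+ q)
      N = ι (+ n)

      P*y≡N*Q : P * y ≡ N * Q
      P*y≡N*Q = trans (solve 3 (λ P n s → P :* (n :* s) := n :* (s :* P)) refl P N (+ q / p))
        (cong (N *_) (/-*-cancel (+ q) p))

    L*q/p≡1 : L * (+ q / p) ≡ 1ℚ
    L*q/p≡1 = *-cancelˡ-≡ (0<* (0<ι p) (0<ι q)) (begin
      P * Q * (L * (+ q / p))   ≡⟨ solve 4 (λ P Q L s → P :* Q :* (L :* s) := (L :* Q) :* (s :* P)) refl P Q L (+ q / p) ⟩
      (L * Q) * (+ q / p * P)   ≡⟨ cong₂ _*_ (/-*-cancel (+ p) q) (/-*-cancel (+ q) p) ⟩
      P * Q                     ≡⟨ ℚ.*-identityʳ (P * Q) ⟨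
      P * Q * 1ℚ                ∎)
      where open ≡-Reasoning

    x*y≡1 : x * y ≡ 1ℚ
    x*y≡1 = trans (solve 3 (λ n x s → x :* (n :* s) := n :* x :* s) refl N x (+ q / p))
      (trans (cong (_* (+ q / p)) n*x≡L) L*q/p≡1)

    -- y - 1/2 = (2nq - p) / 2p.
    m k : ℤ
    m = + 2 ℤ.* (+ n ℤ.* + q) ℤ.- + p
    k = m ℤ./ℕ (2 ℕ.* p)

    private
      2P : ℚ
      2P = ι (+ 2) * P

      0<2P : 0ℚ < 2P
      0<2P = 0<* (0</ 2 1) (0<ι p)

      ι2p : ι (+ (2 ℕ.* p)) ≡ 2P
      ι2p = trans (cong ι (ℤ.pos-* 2 p)) (ι-homo-* (+ 2) (+ p))

      ιm : ι m ≡ 2P * (y - ½)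
      ιm = begin
        ι m                             ≡⟨ ι-homo-+ (+ 2 ℤ.* (+ n ℤ.* + q)) (ℤ.- + p) ⟩
        ι (+ 2 ℤ.* (+ n ℤ.* + q)) + ι (ℤ.- + p)
          ≡⟨ cong₂ _+_ (trans (ι-homo-* (+ 2) (+ n ℤ.* + q)) (cong (ι (+ 2) *_) (ι-homo-* (+ n) (+ q))))
               (trans (cong ι (sym (ℤ.-1*i≡-i (+ p)))) (ι-homo-* ℤ.-1ℤ (+ p))) ⟩
        ι (+ 2) * (N * Q) + ι ℤ.-1ℤ * P  ≡⟨ cong (λ t → ι (+ 2) * t + ι ℤ.-1ℤ * P) P*y≡N*Q ⟨
        ι (+ 2) * (P * y) + ι ℤ.-1ℤ * P
          ≡⟨ solve 2 (λ P y → con (ι (+ 2)) :* (P :* y) :+ con (ι ℤ.-1ℤ) :* P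
               := con (ι (+ 2)) :* P :* (y :- con ½)) refl P y ⟩
        2P * (y - ½)                    ∎
        where open ≡-Reasoning

      -- Here the threshold on `n` enters: P · x = p²/(nq). Divided by 6, the bound says that the
      -- correction x/12, scaled by 2p, uses up at most the one unit by which an integer numerator
      -- falls short of the next multiple of 2p.
      P*x≤6 : P * x ≤ ι (+ 6)
      P*x≤6 = *-cancelˡ-≤ (0<* (0<ι n) (0<ι q)) (begin
        N * Q * (P * x)       ≡⟨ solve 4 (λ N Q P x → N :* Q :* (P :* x) := P :* (N :* x :* Q)) refl N Q P x ⟩
        P * (N * x * Q)       ≡⟨ cong (λ t → P * (t * Q)) n*x≡L ⟩
        P * (L * Q)           ≡⟨ cong (P *_) (/-*-cancel (+ p) q) ⟩
        P * P                 ≡⟨ trans (cong ι (ℤ.pos-* p p)) (ι-homo-* (+ p) (+ p)) ⟨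
        ι (+ (p ℕ.* p))       ≤⟨ ι-mono-≤ (ℤ.+≤+ p²≤n6q) ⟩
        ι (+ (n ℕ.* (6 ℕ.* q)))
          ≡⟨ trans (cong ι (ℤ.pos-* n (6 ℕ.* q))) (trans (ι-homo-* (+ n) (+ (6 ℕ.* q)))
               (cong (N *_) (trans (cong ι (ℤ.pos-* 6 q)) (ι-homo-* (+ 6) (+ q))))) ⟩
        N * (ι (+ 6) * Q)     ≡⟨ solve 3 (λ N Q t → N :* (t :* Q) := N :* Q :* t) refl N Q (ι (+ 6)) ⟩
        N * Q * ι (+ 6)       ∎)
        where open ℚ.≤-Reasoning

    k≤y-½ : ι k ≤ y - ½
    k≤y-½ = *-cancelˡ-≤ 0<2P (begin
      2P * ι k               ≡⟨ ℚ.*-comm 2P (ι k) ⟩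
      ι k * 2P               ≡⟨ cong (ι k *_) ι2p ⟨
      ι k * ι (+ (2 ℕ.* p))  ≡⟨ ι-homo-* k (+ (2 ℕ.* p)) ⟨
      ι (k ℤ.* + (2 ℕ.* p))  ≤⟨ ι-mono-≤ (ℤ.[n/ℕd]*d≤n m (2 ℕ.* p)) ⟩
      ι m                    ≡⟨ ιm ⟩
      2P * (y - ½)           ∎)
      where open ℚ.≤-Reasoning

    -- y - 1/2 lies at least 1/2p below the next integer.
    y-½+x/12≤suc-k : y - ½ + + 1 / 12 * x ≤ ι (ℤ.suc k)
    y-½+x/12≤suc-k = *-cancelˡ-≤ 0<2P (begin
      2P * (y - ½ + + 1 / 12 * x)
        ≡⟨ solve 3 (λ P y x → con (ι (+ 2)) :* P :* (y :- con ½ :+ con (+ 1 / 12) :* x)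
             := con (ι (+ 2)) :* P :* (y :- con ½) :+ con (+ 1 / 6) :* (P :* x)) refl P y x ⟩
      2P * (y - ½) + + 1 / 6 * (P * x)
        ≤⟨ ℚ.+-mono-≤ (ℚ.≤-reflexive (sym ιm)) (ℚ.*-monoˡ-≤-nonNeg (+ 1 / 6) P*x≤6) ⟩
      ι m + 1ℚ                   ≡⟨ ℚ.+-comm (ι m) 1ℚ ⟩
      1ℚ + ι m                   ≡⟨ ι-homo-+ (+ 1) m ⟨
      ι (ℤ.suc m)                ≤⟨ ι-mono-≤ (ℤ.i<j⇒suc[i]≤j (ℤ.n<s[n/ℕd]*d m (2 ℕ.* p))) ⟩
      ι (ℤ.suc k ℤ.* + (2 ℕ.* p))  ≡⟨ ι-homo-* (ℤ.suc k) (+ (2 ℕ.* p)) ⟩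
      ι (ℤ.suc k) * ι (+ (2 ℕ.* p)) ≡⟨ cong (ι (ℤ.suc k) *_) ι2p ⟩
      ι (ℤ.suc k) * 2P           ≡⟨ ℚ.*-comm (ι (ℤ.suc k)) 2P ⟩
      2P * ι (ℤ.suc k)           ∎)
      where open ℚ.≤-Reasoning

-- From rational estimates to statements about ℝ.

open import Algebra.Definitions.RawSemiring ℚ.+-*-rawSemiring using () renaming (_^_ to _^ℚ_)
open import Data.Rational.Base using (ℚ; 0ℚ; 1ℚ; ½; _/_; ∣_∣)
open import Defs

⟶⇒close : ∀ {s l} → s ⟶ l → ∀ ε → 0ℚ ℚ.< ε →
  ∃ λ K → ∀ n → K ℕ.≤ n → Eventually λ j → ∣ seq (s n) j ℚ.- seq l j ∣ ℚ.< ε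
⟶⇒close {s} {l} s⟶l ε 0<ε with K , h ← s⟶l ε 0<ε = K , close
  where
  close : ∀ n → K ℕ.≤ n → Eventually λ j → ∣ seq (s n) j ℚ.- seq l j ∣ ℚ.< ε
  close n K≤n with (δ , 0<δ , I , f) , (η , 0<η , J , g) ← h n K≤n = I ℕ.⊔ J , λ j IJ≤j →
    ∣p-q∣< {seq (s n) j}
      (gap (seq (s n) j) (seq l j) 0<η (g j (ℕ.≤-trans (ℕ.m≤n⊔m I J) IJ≤j)))
      (gap′ (seq (s n) j) (seq l j) 0<δ (f j (ℕ.≤-trans (ℕ.m≤m⊔n I J) IJ≤j)))
    where
    open ℚ.≤-Reasoning
    gap : ∀ a b {η} → 0ℚ ℚ.< η → a ℚ.+ η ℚ.< b ℚ.+ ε → a ℚ.- b ℚ.< ε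
    gap a b {η} 0<η a+η<b+ε = begin-strict
      a ℚ.- b                ≤⟨ 0≤⇒+-≤ (ℚ.<⇒≤ 0<η) refl ⟩
      a ℚ.- b ℚ.+ η          ≡⟨ solve 3 (λ a b η → a :- b :+ η := a :+ η :- b) refl a b η ⟩
      a ℚ.+ η ℚ.- b          <⟨ ℚ.+-monoˡ-< (ℚ.- b) a+η<b+ε ⟩
      b ℚ.+ ε ℚ.- b          ≡⟨ solve 2 (λ b ε → b :+ ε :- b := ε) refl b ε ⟩
      ε                      ∎
    gap′ : ∀ a b {δ} → 0ℚ ℚ.< δ → b ℚ.- ε ℚ.+ δ ℚ.< a → b ℚ.- a ℚ.< ε
    gap′ a b {δ} 0<δ b-ε+δ<a = gap b a 0<δ (begin-strict
      b ℚ.+ δ                ≡⟨ solve 3 (λ b δ ε → b :+ δ := b :- ε :+ δ :+ ε) refl b δ ε ⟩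
      b ℚ.- ε ℚ.+ δ ℚ.+ ε    <⟨ ℚ.+-monoˡ-< ε b-ε+δ<a ⟩
      a ℚ.+ ε                ∎)

seq-^ : ∀ x k j → seq (x ^ k) j ≡ seq x j ^ℚ k
seq-^ x zero    j = refl
seq-^ x (suc k) j = cong (seq x j ℚ.*_) (seq-^ x k j)

seq-expSum : ∀ x n j → seq (expSum (fromℚ x) n) j ≡ E x n
seq-expSum x zero    j = refl
seq-expSum x (suc n) j = cong₂ (λ s t → s ℚ.+ 1/! n ℚ.* t) (seq-expSum x n j) (seq-^ (fromℚ x) n j)

-- In `⟶⇒close` the threshold on j depends on n. Partial sums at a rational are constant sequences,
-- so they may be compared with `y` at any late index, from which the modulus of `y` leads to j; one
-- K then serves both indices.
E-close-exp : ∀ {x y} → IsExp (fromℚ x) y → ∀ ε → 0ℚ ℚ.< ε →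
  ∃ λ K → ∀ n j → K ℕ.≤ n → K ℕ.≤ j → ∣ E x n ℚ.- seq y j ∣ ℚ.< ε
E-close-exp {x} {y} exp ε 0<ε =
  let I , f = ⟶⇒close {expSum (fromℚ x)} {y} exp (½ ℚ.* ε) (0<½* 0<ε)
      J , g = cauchy y (½ ℚ.* ε) (0<½* 0<ε)
  in I ℕ.⊔ J , λ n j IJ≤n IJ≤j →
  let H , h = f n (ℕ.≤-trans (ℕ.m≤m⊔n I J) IJ≤n)
      i     = H ℕ.⊔ J
  in subst (∣ E x n ℚ.- seq y j ∣ ℚ.<_) (½+½ ε)
      (close-trans {E x n} {seq y i} {seq y j} {½ ℚ.* ε} {½ ℚ.* ε}
        (subst (λ t → ∣ t ℚ.- seq y i ∣ ℚ.< ½ ℚ.* ε) (seq-expSum x n i) (h i (ℕ.m≤m⊔n H J)))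
        (g i j (ℕ.m≤n⊔m H J) (ℕ.≤-trans (ℕ.m≤n⊔m I J) IJ≤j)))

≡⇒≃ : ∀ {x y} → (∀ n → seq x n ≡ seq y n) → x ≃ y
≡⇒≃ {x} {y} x≡y ε 0<ε = 0 , λ n _ → subst (λ t → ∣ t ∣ ℚ.< ε)
  (sym (trans (cong (ℚ._- seq y n) (x≡y n)) (ℚ.+-inverseʳ (seq y n)))) 0<ε

-- The strict upper bound needs a fixed gap that still leaves strict inequalities; a rational `m`
-- strictly between `c` and the next integer provides it.
isFloor : ∀ {x k c} → (∀ n → k / 1 ℚ.≤ seq x n) → Eventually (λ n → seq x n ℚ.≤ c) →
          c ℚ.< ℤ.suc k / 1 → IsFloor x k
isFloor {x} {k} {c} k≤x (K , x≤c) c<suc-k with m , c<m , m<suc-k ← ℚ.<-dense c<suc-k =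
  (λ ε 0<ε → 0 , λ n _ → ℚ.≤-<-trans (k≤x n) (0<⇒+-< 0<ε refl)) ,
  s ℚ.- m , 0<s-m , K , λ n K≤n → begin-strict
    seq x n ℚ.+ (s ℚ.- m)   ≤⟨ ℚ.+-monoˡ-≤ (s ℚ.- m) (x≤c n K≤n) ⟩
    c ℚ.+ (s ℚ.- m)         <⟨ ℚ.+-monoˡ-< (s ℚ.- m) c<m ⟩
    m ℚ.+ (s ℚ.- m)         ≡⟨ solve 2 (λ m s → m :+ (s :- m) := s) refl m s ⟩
    s                       ∎
  where
  open ℚ.≤-Reasoning
  s = ℤ.suc k / 1
  0<s-m : 0ℚ ℚ.< s ℚ.- m
  0<s-m = ℚ.≤-<-trans (ℚ.≤-reflexive (sym (ℚ.+-inverseʳ m))) (ℚ.+-monoˡ-< (ℚ.- m) m<suc-k)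

-- The root of θ and the reciprocal as Cauchy sequences.

module Root {θ : ℝ} {L x y : ℚ} (exp : IsExp (fromℚ L) θ) (n : ℕ)
  (0<x : 0ℚ ℚ.< x) (n*x≡L : + suc n / 1 ℚ.* x ≡ L) (xy≡1 : x ℚ.* y ≡ 1ℚ) where
  open Bounds 0<x xy≡1

  private 0≤x = ℚ.<⇒≤ 0<x

  x≤L : x ℚ.≤ L
  x≤L = 0≤⇒+-≤ (0≤* (0≤ι n) 0≤x) (trans (sym (ι-suc-* n x)) n*x≡L)

  -- The shift by two makes the sequence of `root - 1ℝ` definitionally equal to `d`.
  root : ℝ
  root = mkℝ (λ i → E x (2 ℕ.+ i)) root-cauchy
    where
    root-cauchy : IsCauchy (λ i → E x (2 ℕ.+ i))
    root-cauchy ε 0<ε =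
      let K , h = E-close-exp {L} {θ} exp (½ ℚ.* ε) (0<½* 0<ε) in
      -- Both partial sums at `L` are near the same approximation of θ, hence near each other;
      -- `E-close` carries this down to `x`.
      K , λ i j K≤i K≤j → E-close 0≤x x≤L (2 ℕ.+ i) (2 ℕ.+ j)
        (subst (∣ E L (2 ℕ.+ i) ℚ.- E L (2 ℕ.+ j) ∣ ℚ.<_) (½+½ ε)
          (close-trans {E L (2 ℕ.+ i)} {seq θ K} {E L (2 ℕ.+ j)} {½ ℚ.* ε} {½ ℚ.* ε}
            (h (2 ℕ.+ i) K (ℕ.m≤n⇒m≤o+n 2 K≤i) ℕ.≤-refl)
            (close-sym {E L (2 ℕ.+ j)} (h (2 ℕ.+ j) K (ℕ.m≤n⇒m≤o+n 2 K≤j) ℕ.≤-refl))))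

  root-isRoot : IsRoot (suc n) θ root
  root-isRoot = (x , 0<x , 0 , λ i _ → positive i) , power
    where
    positive : ∀ i → 0ℚ ℚ.+ x ℚ.< E x (2 ℕ.+ i)
    positive i = ℚ.≤-<-trans (ℚ.≤-reflexive (ℚ.+-identityˡ x)) (ℚ.≤-<-trans (x≤d i)
      (0<⇒+-< (0</ 1 1) (solve 1 (λ s → s :- con 1ℚ :+ con 1ℚ := s) refl (E x (2 ℕ.+ i)))))
    power : root ^ suc n ≃ θ
    power ε 0<ε = let K , h = E-close-exp {L} {θ} exp ε 0<ε in K , λ i K≤i →
      subst (λ t → ∣ t ℚ.- seq θ i ∣ ℚ.< ε) (sym (seq-^ root (suc n) i))
        (let K≤2+i = ℕ.m≤n⇒m≤o+n 2 K≤i in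
         close-squeeze
          -- Both ends of the squeeze are partial sums at `L` of length at least K, so the same ε
          -- bounds their distances to θ.
          (subst (λ z → E z (2 ℕ.+ i) ℚ.≤ E x (2 ℕ.+ i) ^ℚ suc n) n*x≡L (E-*-≤ 0≤x n (2 ℕ.+ i)))
          (subst (λ z → E x (2 ℕ.+ i) ^ℚ suc n ℚ.≤ E z (suc n ℕ.* (2 ℕ.+ i))) n*x≡L (≤-E-* 0≤x n (2 ℕ.+ i)))
          (h (2 ℕ.+ i) i K≤2+i K≤i)
          (h (suc n ℕ.* (2 ℕ.+ i)) i (ℕ.≤-trans K≤2+i (ℕ.m≤m+n (2 ℕ.+ i) (n ℕ.* (2 ℕ.+ i)))) K≤i))

  reciprocal : ℝ
  reciprocal = mkℝ (λ i → recip (0<d i)) reciprocal-cauchy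
    where
    reciprocal-cauchy : IsCauchy (λ i → recip (0<d i))
    reciprocal-cauchy ε 0<ε =
      -- The factor x · x is the b² of `recip-close`, with the lower bound b = x.
      let K , h = cauchy (root - 1ℝ) (x ℚ.* x ℚ.* ε) (0<* (0<* 0<x 0<x) 0<ε) in
      K , λ i j K≤i K≤j →
        recip-close 0<x (x≤d i) (x≤d j) (0<d i) (0<d j) 0<ε (h i j K≤i K≤j)

  isM′ : ∀ {k} → k / 1 ℚ.≤ y ℚ.- ½ → y ℚ.- ½ ℚ.+ + 1 / 12 ℚ.* x ℚ.≤ ℤ.suc k / 1 →
         IsM′ θ (suc n) k
  isM′ {k} k≤ ≤suc-k = root , reciprocal , root-isRoot ,
    ≡⇒≃ {(root - 1ℝ) * reciprocal} {1ℝ} (λ i → *-recip (0<d i)) ,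
    isFloor {reciprocal} {k} (λ i → ℚ.≤-trans k≤ (y-½≤recip-d i))
      (5 , λ i 5≤i → recip-antimono-≤ (0<d 5) (0<d i) (d-mono-≤ 5≤i))
      (ℚ.<-≤-trans recip-d<y-½+x/12 ≤suc-k)

-- Exclusion beyond the bound, and finiteness.

module _ (p q : ℕ) .{{_ : NonZero p}} .{{_ : NonZero q}} where
  private instance _ = m*n≢0 6 q

  bound : ℚ
  bound = + (p ℕ.^ 2) / (6 ℕ.* q)

  bound≤⇒∉𝒜 : ∀ {θ} → IsLog θ (fromℚ (+ p / q)) → ∀ n → bound ℚ.≤ + suc n / 1 → ¬ 𝒜 θ (suc n)
  bound≤⇒∉𝒜 {θ} log n bound≤n (_ , differ) =
    differ {k} {k} (isM′ {k} k≤y-½ y-½+x/12≤suc-k) isLogFloor refl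
    where
    p²≤n6q : p ℕ.* p ℕ.≤ suc n ℕ.* (6 ℕ.* q)
    p²≤n6q = ℤ.drop‿+≤+ (ι-cancel-≤ (begin
      + (p ℕ.* p) / 1                        ≡⟨ cong (λ t → + (p ℕ.* t) / 1) (ℕ.*-identityʳ p) ⟨
      + (p ℕ.^ 2) / 1                        ≡⟨ /-*-cancel (+ (p ℕ.^ 2)) (6 ℕ.* q) ⟨
      bound ℚ.* (+ (6 ℕ.* q) / 1)
        ≤⟨ ℚ.*-monoʳ-≤-nonNeg (+ (6 ℕ.* q) / 1) {{ℚ.nonNegative (0≤ι (6 ℕ.* q))}} bound≤n ⟩
      (+ suc n / 1) ℚ.* (+ (6 ℕ.* q) / 1)    ≡⟨ ι-homo-* (+ suc n) (+ (6 ℕ.* q)) ⟨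
      (+ suc n ℤ.* + (6 ℕ.* q)) / 1          ≡⟨ cong (_/ 1) (ℤ.pos-* (suc n) (6 ℕ.* q)) ⟨
      + (suc n ℕ.* (6 ℕ.* q)) / 1            ∎))
      where open ℚ.≤-Reasoning
    open Rounding p q (suc n) p²≤n6q
    open Root {θ} log n 0<x n*x≡L x*y≡1
    isLogFloor : IsLogFloor θ (suc n) k
    isLogFloor = fromℚ L , fromℚ (+ q / p) , log , ≡⇒≃ {fromℚ L * fromℚ (+ q / p)} {1ℝ} (λ _ → L*q/p≡1) ,
      isFloor {fromℕ (suc n) * fromℚ (+ q / p) - fromℚ ½} {k} {y ℚ.- ½} (λ _ → k≤y-½) (0 , λ _ _ → ℚ.≤-refl)
        -- The sequence is constant, so c is its value y - 1/2; strictness comes from the positive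
        -- slack x/12.
        (ℚ.<-≤-trans (0<⇒+-< (0<* (0</ 1 12) 0<x) refl) y-½+x/12≤suc-k)

  -- As 6q ≥ 1, the natural number p² dominates the bound and can serve as the length of the list.
  <bound⇒<p² : ∀ n → + n / 1 ℚ.< bound → n ℕ.< p ℕ.^ 2
  <bound⇒<p² n n<bound = ℕ.≰⇒> λ p²≤n → ℚ.<-irrefl refl (begin-strict
    + n / 1                            <⟨ n<bound ⟩
    bound                              ≡⟨ ℚ.*-identityʳ bound ⟨
    bound ℚ.* 1ℚ
      ≤⟨ ℚ.*-monoˡ-≤-nonNeg bound {{ℚ.normalize-nonNeg (p ℕ.^ 2) (6 ℕ.* q)}}
           (ι-mono-≤ (ℤ.+≤+ (ℕ.>-nonZero⁻¹ (6 ℕ.* q)))) ⟩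
    bound ℚ.* (+ (6 ℕ.* q) / 1)        ≡⟨ /-*-cancel (+ (p ℕ.^ 2)) (6 ℕ.* q) ⟩
    + (p ℕ.^ 2) / 1                    ≤⟨ ι-mono-≤ (ℤ.+≤+ p²≤n) ⟩
    + n / 1                            ∎)
    where open ℚ.≤-Reasoning

theorem2 : (θ : ℝ) → 1ℝ < θ →
    (p q : ℕ) .{{_ : NonZero p}} .{{_ : NonZero q}} →
    IsLog θ (fromℚ (+ p / q)) → 1ℚ ℚ.< + p / q →
    (𝒜 θ ⊆ [ 1ℚ , (+ (p ℕ.^ 2) / (6 ℕ.* q)) {{m*n≢0 6 q}} ⟩) × Finite (𝒜 θ)
theorem2 θ _ p q log _ = 𝒜⊆ , upTo (p ℕ.^ 2) , λ {n} n∈𝒜 →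
  ∈-upTo⁺ (<bound⇒<p² p q n (proj₂ (𝒜⊆ {n} n∈𝒜)))
  where
  𝒜⊆ : 𝒜 θ ⊆ [ 1ℚ , (+ (p ℕ.^ 2) / (6 ℕ.* q)) {{m*n≢0 6 q}} ⟩
  -- There is no case for 0 because `𝒜 θ 0` contains the empty `NonZero 0`.
  𝒜⊆ {suc n} n∈𝒜 = ι-mono-≤ {+ 1} {+ suc n} (ℤ.+≤+ (ℕ.s≤s ℕ.z≤n)) ,
    ℚ.≰⇒> (λ bound≤n → bound≤⇒∉𝒜 p q {θ} log n bound≤n n∈𝒜)
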